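{- For every positive integer $n$, the equational theory of the variety $\mathsf{V}(\mathbf{F}_n(\mathbb{Z}))$ is decidable.
   Context: For a chain $\Omega$ and an order-preserving map $f:\Omega\to\Omega$, the residual is $f^r(b)=\max\{a: f(a)\le b\}$ and the dual residual is $f^\ell(a)=\min\{b: a\le f(b)\}$, when these exist. $\mathbf{F}(\Omega)$ is the set of all maps on $\Omega$ having residuals and dual residuals of all orders, an $\ell$-pregroup under composition, identity, pointwise order, ${}^\ell$ and ${}^r$ (an $\ell$-pregroup is a lattice-ordered monoid $(A,\wedge,\vee,\cdot,{}^\ell,{}^r,1)$ with order-preserving multiplication and $x^\ell x\le1\le xx^\ell$, $xx^r\le 1\le x^rx$). $\mathbf{F}_n(\Omega)$ is the subalgebra of those $f$ with $f^{\ell^n}=f^{r^n}$. $\mathsf{V}(\mathbf{A})$ is the variety generated by $\mathbf{A}$. -}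

module Defs where

open import Data.Nat using (ℕ; zero; suc)
open import Data.Integer using (ℤ; _≤_; _⊓_; _⊔_)
open import Data.Product using (_×_)
open import Relation.Binary.PropositionalEquality using (_≡_)

OrderPreserving : (ℤ → ℤ) → Set
OrderPreserving f = ∀ {a b} → a ≤ b → f a ≤ f b

IsResidual : (ℤ → ℤ) → (ℤ → ℤ) → Set
IsResidual f g = ∀ b → (f (g b) ≤ b) × (∀ a → f a ≤ b → a ≤ g b)

IsDualResidual : (ℤ → ℤ) → (ℤ → ℤ) → Set
IsDualResidual f h = ∀ a → (a ≤ f (h a)) × (∀ b → a ≤ f b → h a ≤ b)

-- Elements of F_n(ℤ): order-preserving maps f having residuals and dual
-- residuals of all orders (rseq k = f^{r^k}, lseq k = f^{ℓ^k}), with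
-- f^{ℓ^n} = f^{r^n}.
record Fn (n : ℕ) : Set where
  field
    fun  : ℤ → ℤ
    mono : OrderPreserving fun
    rseq : ℕ → ℤ → ℤ
    lseq : ℕ → ℤ → ℤ
    r0   : ∀ x → rseq zero x ≡ fun x
    l0   : ∀ x → lseq zero x ≡ fun x
    rres : ∀ k → IsResidual (rseq k) (rseq (suc k))
    lres : ∀ k → IsDualResidual (lseq k) (lseq (suc k))
    eqn  : ∀ x → lseq n x ≡ rseq n x

data Term : Set where
  var  : ℕ → Term
  one  : Term
  _·_  : Term → Term → Term
  _∧_  : Term → Term → Term
  _∨_  : Term → Term → Term
  _ˡ   : Term → Term
  _ʳ   : Term → Term

data Eval {n : ℕ} (ρ : ℕ → Fn n) : Term → (ℤ → ℤ) → Set where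
  ev-var  : ∀ i → Eval ρ (var i) (Fn.fun (ρ i))
  ev-one  : Eval ρ one (λ x → x)
  ev-mul  : ∀ {s t f g} → Eval ρ s f → Eval ρ t g → Eval ρ (s · t) (λ x → f (g x))
  ev-meet : ∀ {s t f g} → Eval ρ s f → Eval ρ t g → Eval ρ (s ∧ t) (λ x → f x ⊓ g x)
  ev-join : ∀ {s t f g} → Eval ρ s f → Eval ρ t g → Eval ρ (s ∨ t) (λ x → f x ⊔ g x)
  ev-l    : ∀ {t f h} → Eval ρ t f → IsDualResidual f h → Eval ρ (t ˡ) h
  ev-r    : ∀ {t f g} → Eval ρ t f → IsResidual f g → Eval ρ (t ʳ) g

-- The equation s ≈ t holds in F_n(ℤ) (equivalently, in V(F_n(ℤ))).
Valid : ℕ → Term → Term → Set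
Valid n s t = ∀ (ρ : ℕ → Fn n) (f g : ℤ → ℤ) → Eval ρ s f → Eval ρ t g → ∀ x → f x ≡ g x

{-# OPTIONS --safe #-}
module Submission where

open import Defs
import Data.Fin as Fin
import Data.Integer as ℤ
import Data.Integer.Properties as ℤₚ
import Data.List.Relation.Unary.All as All
import Data.Nat as ℕ
import Data.Nat.Properties as ℕₚ
open import Algebra.Properties.AbelianGroup ℤₚ.+-0-abelianGroup using (∙-cancelʳ)
open import Data.Bool using (Bool; true; false; not)
open import Data.Empty using (⊥-elim)
open import Data.Fin using (Fin; toℕ; fromℕ<)
open import Data.Fin.Properties using (toℕ-fromℕ<; toℕ<n; all?; fromℕ<-cong)
open import Data.Integer using (ℤ; +_; -_; _+_; _-_; _*_; _⊓_; _⊔_; 0ℤ; 1ℤ; ∣_∣; _/ℕ_; _%ℕ_)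
open import Data.Integer.DivMod using (n%ℕd<d; a≡a%ℕn+[a/ℕn]*n; [n/ℕd]*d≤n; n<s[n/ℕd]*d)
open import Data.Integer.Tactic.RingSolver using (solve-∀)
open import Data.List using (List; []; _∷_; _++_; map; length; upTo; replicate; cartesianProduct; cartesianProductWith)
open import Data.List.Membership.Propositional using (_∈_; find; lose)
open import Data.List.Membership.Propositional.Properties using (∈-map⁺; ∈-map⁻; ∈-++⁺ˡ; ∈-++⁺ʳ; ∈-++⁻; ∈-upTo⁺; ∈-upTo⁻; ∈-cartesianProduct⁺; ∈-cartesianProduct⁻; ∈-cartesianProductWith⁺)
open import Data.List.Relation.Unary.All using (All)
open import Data.List.Relation.Unary.Any using (Any; here; there; any?)
open import Data.Nat using (ℕ; zero; suc; NonZero; _≤_)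
open import Data.Product using (Σ; _×_; _,_; proj₁; proj₂)
open import Data.Product.Properties using (≡-dec)
open import Data.Sum using (_⊎_; inj₁; inj₂; [_,_]′) renaming (map to map⊎)
open import Data.Vec using (Vec; []; _∷_; lookup; tabulate)
open import Data.Vec.Properties using (lookup∘tabulate)
open import Function using (_∘_; id)
open import Relation.Binary.Definitions using (DecidableEquality)
open import Relation.Binary.PropositionalEquality using (_≡_; refl; sym; trans; cong; cong₂; subst; subst₂; _≗_; module ≡-Reasoning)
open import Relation.Nullary using (Dec; yes; no; ¬_)
open import Relation.Nullary.Decidable using (map′; _×-dec_; _⊎-dec_; ¬?; decidable-stable)

-- On ℤ the condition on f in the definition of Fn n says exactly f (x + n) = f x + n, so every f is one of
-- finitely many "shapes" followed by a translation by k n. Residuals can be pushed down to the variables. For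
-- fixed shapes, the value of a term at a point is then a lattice combination of affine forms in the
-- translation lengths k, and an equation becomes a positive Boolean combination of conditions 0 ≤ L k + c that
-- has to hold for all integers k. Reading k in binary, k = 2 k′ + e, replaces c by ⌊(L e + c) / 2⌋; the
-- constants stay bounded, so a counterexample is a path in a finite graph.

-- Residuals on ℤ

-- On ℤ, taking the dual residual twice conjugates a map by the successor map, so equality of the
-- n-th dual residual and the n-th residual amounts to invariance under conjugation by translation
-- by n. Translations by multiples of n then commute with every map in play. They can be pulled out
-- of compositions and residuals, and each occurrence of a variable contributes its translation
-- length with coefficient 1 or -1; this is why the lengths can stay unknowns while everything else
-- is computed outright. The obstacle is that the lengths are unbounded and are shared by all
-- inequalities of one Boolean combination, so the inequalities cannot be decided one at a time. A
-- state of the graph therefore records the constants of all of them together, and one vector of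
-- digits moves them simultaneously.

≤-move : ∀ {a b c d} → b - a ≡ d - c → a ℤ.≤ b → c ℤ.≤ d
≤-move e p = ℤₚ.0≤i-j⇒j≤i (subst (0ℤ ℤ.≤_) e (ℤₚ.i≤j⇒0≤j-i p))

≰⇒1+≤ : ∀ {a b} → ¬ a ℤ.≤ b → 1ℤ + b ℤ.≤ a
≰⇒1+≤ = ℤₚ.i<j⇒suc[i]≤j ∘ ℤₚ.≰⇒>

1+≤⇒≰ : ∀ {a b} → 1ℤ + b ℤ.≤ a → ¬ a ℤ.≤ b
1+≤⇒≰ = ℤₚ.<⇒≱ ∘ ℤₚ.suc[i]≤j⇒i<j

-- A Galois connection: `g` is the residual of `f` and `f` is the dual residual of `g`. Unlike
-- `IsResidual` alone, it forces both maps to be monotone, and it treats the two kinds of residual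
-- symmetrically.
Adj : (ℤ → ℤ) → (ℤ → ℤ) → Set
Adj f g = ∀ a b → (f a ℤ.≤ b → a ℤ.≤ g b) × (a ℤ.≤ g b → f a ℤ.≤ b)

adj-cong : ∀ {f f′ g g′} → f ≗ f′ → g ≗ g′ → Adj f g → Adj f′ g′
adj-cong e e′ p a b rewrite sym (e a) | sym (e′ b) = p a b

adj-uniqueʳ : ∀ {f g g′} → Adj f g → Adj f g′ → g ≗ g′
adj-uniqueʳ p q b = ℤₚ.≤-antisym (proj₁ (q _ b) (proj₂ (p _ b) ℤₚ.≤-refl))
                                 (proj₁ (p _ b) (proj₂ (q _ b) ℤₚ.≤-refl))

adj-uniqueˡ : ∀ {f f′ g} → Adj f g → Adj f′ g → f ≗ f′
adj-uniqueˡ p q a = ℤₚ.≤-antisym (proj₂ (p a _) (proj₁ (q a _) ℤₚ.≤-refl))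
                                 (proj₂ (q a _) (proj₁ (p a _) ℤₚ.≤-refl))

adj-monoˡ : ∀ {f g} → Adj f g → OrderPreserving f
adj-monoˡ p a≤b = proj₂ (p _ _) (ℤₚ.≤-trans a≤b (proj₁ (p _ _) ℤₚ.≤-refl))

adj-monoʳ : ∀ {f g} → Adj f g → OrderPreserving g
adj-monoʳ p a≤b = proj₁ (p _ _) (ℤₚ.≤-trans (proj₂ (p _ _) ℤₚ.≤-refl) a≤b)

adj-id : Adj id id
adj-id a b = id , id

adj-∘ : ∀ {f g f′ g′} → Adj f g → Adj f′ g′ → Adj (f ∘ f′) (g′ ∘ g)
adj-∘ p q a b = proj₁ (q _ _) ∘ proj₁ (p _ _) , proj₂ (p _ _) ∘ proj₂ (q _ _)

⊓≤⇒≤⊎≤ : ∀ {i j k} → i ⊓ j ℤ.≤ k → i ℤ.≤ k ⊎ j ℤ.≤ k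
⊓≤⇒≤⊎≤ {i} {j} {k} h with ℤₚ.⊓-sel i j
... | inj₁ e = inj₁ (subst (ℤ._≤ k) e h)
... | inj₂ e = inj₂ (subst (ℤ._≤ k) e h)

≤⊎≤⇒⊓≤ : ∀ {i j k} → i ℤ.≤ k ⊎ j ℤ.≤ k → i ⊓ j ℤ.≤ k
≤⊎≤⇒⊓≤ {j = j} (inj₁ p) = ℤₚ.i≤j⇒i⊓k≤j j p
≤⊎≤⇒⊓≤ {i = i} (inj₂ p) = ℤₚ.i≤j⇒k⊓i≤j i p

≤⊔⇒≤⊎≤ : ∀ {i j k} → k ℤ.≤ i ⊔ j → k ℤ.≤ i ⊎ k ℤ.≤ j
≤⊔⇒≤⊎≤ {i} {j} {k} h with ℤₚ.⊔-sel i j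
... | inj₁ e = inj₁ (subst (k ℤ.≤_) e h)
... | inj₂ e = inj₂ (subst (k ℤ.≤_) e h)

≤⊎≤⇒≤⊔ : ∀ {i j k} → k ℤ.≤ i ⊎ k ℤ.≤ j → k ℤ.≤ i ⊔ j
≤⊎≤⇒≤⊔ {j = j} (inj₁ p) = ℤₚ.i≤j⇒i≤j⊔k j p
≤⊎≤⇒≤⊔ {i = i} (inj₂ p) = ℤₚ.i≤j⇒i≤k⊔j i p

≤⊓⇒≤×≤ : ∀ {i j k} → k ℤ.≤ i ⊓ j → k ℤ.≤ i × k ℤ.≤ j
≤⊓⇒≤×≤ {i} {j} h = ℤₚ.≤-trans h (ℤₚ.i⊓j≤i i j) , ℤₚ.≤-trans h (ℤₚ.i⊓j≤j i j)

⊔≤⇒≤×≤ : ∀ {i j k} → i ⊔ j ℤ.≤ k → i ℤ.≤ k × j ℤ.≤ k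
⊔≤⇒≤×≤ {i} {j} h = ℤₚ.≤-trans (ℤₚ.i≤i⊔j i j) h , ℤₚ.≤-trans (ℤₚ.i≤j⊔i i j) h

adj-⊓⊔ : ∀ {f g f′ g′} → Adj f g → Adj f′ g′ → Adj (λ x → f x ⊓ f′ x) (λ x → g x ⊔ g′ x)
adj-⊓⊔ p q a b = ≤⊎≤⇒≤⊔ ∘ map⊎ (proj₁ (p a b)) (proj₁ (q a b)) ∘ ⊓≤⇒≤⊎≤ ,
                 ≤⊎≤⇒⊓≤ ∘ map⊎ (proj₂ (p a b)) (proj₂ (q a b)) ∘ ≤⊔⇒≤⊎≤

adj-⊔⊓ : ∀ {f g f′ g′} → Adj f g → Adj f′ g′ → Adj (λ x → f x ⊔ f′ x) (λ x → g x ⊓ g′ x)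
adj-⊔⊓ p q a b =
  (λ h → ℤₚ.⊓-glb (proj₁ (p a b) (proj₁ (⊔≤⇒≤×≤ h))) (proj₁ (q a b) (proj₂ (⊔≤⇒≤×≤ h)))) ,
  (λ h → ℤₚ.⊔-lub (proj₂ (p a b) (proj₁ (≤⊓⇒≤×≤ h))) (proj₂ (q a b) (proj₂ (≤⊓⇒≤×≤ h))))

adj-+ : ∀ c → Adj (_+ c) (_- c)
adj-+ c a b = ≤-move (lem₁ a b c) , ≤-move (sym (lem₁ a b c))
  where
  lem₁ : ∀ a b c → b - (a + c) ≡ b - c - a
  lem₁ = solve-∀

-- On ℤ the negation of "x ≤ y" is "y + 1 ≤ x", so a left adjoint of f also yields a right adjoint of f.
adj-flipʳ : ∀ {f h} → Adj h f → Adj f (λ x → h (x + 1ℤ) - 1ℤ)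
adj-flipʳ {f} {h} p a b = to , from
  where
  lem₁ : ∀ a y → y - (1ℤ + a) ≡ y - 1ℤ - a
  lem₁ = solve-∀
  lem₂ : ∀ a b → a - (1ℤ + b) ≡ a - (b + 1ℤ)
  lem₂ = solve-∀
  to : f a ℤ.≤ b → a ℤ.≤ h (b + 1ℤ) - 1ℤ
  to fa≤b = ≤-move (lem₁ a (h (b + 1ℤ))) (≰⇒1+≤ λ h≤a →
    1+≤⇒≰ (≤-move (sym (lem₂ (f a) b)) (proj₁ (p (b + 1ℤ) a) h≤a)) fa≤b)
  from : a ℤ.≤ h (b + 1ℤ) - 1ℤ → f a ℤ.≤ b
  from a<h with f a ℤ.≤? b
  ... | yes q = q
  ... | no ¬q = ⊥-elim (1+≤⇒≰ (≤-move (sym (lem₁ a (h (b + 1ℤ)))) a<h)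
                  (proj₂ (p (b + 1ℤ) a) (≤-move (lem₂ (f a) b) (≰⇒1+≤ ¬q))))

-- The mirror image of `adj-flipʳ`. Thanks to it only right residuals have to be found by a search;
-- dual residuals follow by conjugation with the successor map.
adj-flipˡ : ∀ {f g} → Adj f g → Adj (λ x → g (x - 1ℤ) + 1ℤ) f
adj-flipˡ {f} {g} p a b = to , from
  where
  lem₁ : ∀ b y → b - (1ℤ + y) ≡ b - (y + 1ℤ)
  lem₁ = solve-∀
  lem₃ : ∀ a y → a - (1ℤ + y) ≡ a - 1ℤ - y
  lem₃ = solve-∀
  to : g (a - 1ℤ) + 1ℤ ℤ.≤ b → a ℤ.≤ f b
  to h with a ℤ.≤? f b
  ... | yes q = q
  ... | no ¬q = ⊥-elim (1+≤⇒≰ (≤-move (sym (lem₁ b (g (a - 1ℤ)))) h)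
                  (proj₁ (p b (a - 1ℤ)) (≤-move (lem₃ a (f b)) (≰⇒1+≤ ¬q))))
  from : a ℤ.≤ f b → g (a - 1ℤ) + 1ℤ ℤ.≤ b
  from h = ≤-move (lem₁ b (g (a - 1ℤ))) (≰⇒1+≤ λ q →
    1+≤⇒≰ (≤-move (sym (lem₃ a (f b))) (proj₂ (p b (a - 1ℤ)) q)) h)

isResidual⇒adj : ∀ {f g} → OrderPreserving f → IsResidual f g → Adj f g
isResidual⇒adj m p a b = proj₂ (p b) a , λ h → ℤₚ.≤-trans (m h) (proj₁ (p b))

isDualResidual⇒adj : ∀ {f h} → OrderPreserving f → IsDualResidual f h → Adj h f
isDualResidual⇒adj m p a b = (λ q → ℤₚ.≤-trans (proj₁ (p a)) (m q)) , proj₂ (p a) b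

adj⇒isResidual : ∀ {f g} → Adj f g → IsResidual f g
adj⇒isResidual p b = proj₂ (p _ b) ℤₚ.≤-refl , λ a → proj₁ (p a b)

adj⇒isDualResidual : ∀ {f h} → Adj h f → IsDualResidual f h
adj⇒isDualResidual p a = proj₁ (p a _) ℤₚ.≤-refl , λ b → proj₂ (p a b)

-- Periodic maps: commuting with a translation

Commutes : (ℤ → ℤ) → ℤ → Set
Commutes f c = ∀ x → f (x + c) ≡ f x + c

commutes-neg : ∀ f {c} → Commutes f c → Commutes f (- c)
commutes-neg f {c} p x = begin
  f (x - c)             ≡⟨ lem (f (x - c)) c ⟩
  f (x - c) + c - c     ≡⟨ cong (_- c) (p (x - c)) ⟨
  f (x - c + c) - c     ≡⟨ cong (λ y → f y - c) (lem′ x c) ⟩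
  f x - c               ∎
  where
  open ≡-Reasoning
  lem : ∀ y c → y ≡ y + c - c
  lem = solve-∀
  lem′ : ∀ y c → y - c + c ≡ y
  lem′ = solve-∀

commutes-* : ∀ f {c} → Commutes f c → ∀ q → Commutes f (q * c)
commutes-* f {c} p = go
  where
  open ≡-Reasoning
  pos : ∀ j → Commutes f (+ j * c)
  pos zero x = trans (cong f (lem x c)) (sym (lem (f x) c))
    where
    lem : ∀ x c → x + 0ℤ * c ≡ x
    lem = solve-∀
  pos (suc j) x = begin
    f (x + + suc j * c)       ≡⟨ cong (λ y → f (x + y)) (ℤₚ.suc-* (+ j) c) ⟩
    f (x + (c + + j * c))     ≡⟨ cong f (ℤₚ.+-assoc x c _) ⟨
    f (x + c + + j * c)       ≡⟨ pos j (x + c) ⟩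
    f (x + c) + + j * c       ≡⟨ cong (_+ + j * c) (p x) ⟩
    f x + c + + j * c         ≡⟨ ℤₚ.+-assoc (f x) c _ ⟩
    f x + (c + + j * c)       ≡⟨ cong (λ y → f x + y) (ℤₚ.suc-* (+ j) c) ⟨
    f x + + suc j * c         ∎
  go : ∀ q → Commutes f (q * c)
  go (+ j) = pos j
  go (ℤ.-[1+ j ]) x = subst (λ y → f (x + y) ≡ f x + y) (ℤₚ.neg-distribˡ-* (+ suc j) c) (commutes-neg f (pos (suc j)) x)

-- The two composites of `f` with translation by `c` coincide, hence so do their right adjoints,
-- which are the two composites of `g` with translation by `- c`.
commutes-adjʳ : ∀ {f g} {c} → Adj f g → Commutes f c → Commutes g c
commutes-adjʳ {f} {g} {c} p e x =
  subst (λ d → g (x + d) ≡ g x + d) (ℤₚ.neg-involutive c) (commutes-neg g {c = - c} g-c x)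
  where
  g-c : Commutes g (- c)
  g-c = adj-uniqueʳ (adj-∘ (adj-+ c) p) (adj-cong e (λ _ → refl) (adj-∘ p (adj-+ c)))

commutes-adjˡ : ∀ {f g c} → Adj f g → Commutes g c → Commutes f c
commutes-adjˡ {f} {g} {c} p e =
  adj-uniqueˡ (adj-∘ p (adj-+ c)) (adj-cong (λ _ → refl) (commutes-neg g e) (adj-∘ (adj-+ c) p))

below-max : ∀ {f a b c} → OrderPreserving f → f c ℤ.≤ b × ¬ f (1ℤ + c) ℤ.≤ b → f a ℤ.≤ b → a ℤ.≤ c
below-max {a = a} {c = c} m (_ , fc≰b) fa≤b with a ℤ.≤? c
... | yes p = p
... | no ¬p = ⊥-elim (fc≰b (ℤₚ.≤-trans (m (≰⇒1+≤ ¬p)) fa≤b))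

record Per (n : ℕ) : Set where
  field
    fun  : ℤ → ℤ
    mono : OrderPreserving fun
    per  : Commutes fun (+ n)
open Per

boundary : ∀ (P : ℕ → Set) → (∀ j → Dec (P j)) → ∀ m → P 0 → ¬ P m → Σ ℕ λ j → P j × ¬ P (suc j)
boundary P P? zero p₀ ¬p = ⊥-elim (¬p p₀)
boundary P P? (suc m) p₀ ¬p with P? m
... | yes p  = m , p , ¬p
... | no ¬p′ = boundary P P? m p₀ ¬p′

module _ {n : ℕ} .{{_ : NonZero n}} where

  per-* : (f : Per n) → ∀ q → Commutes (fun f) (q * + n)
  per-* f = commutes-* (fun f) (per f)

  -- With q the quotient of b - f 0 by n, periodicity gives f (q n) = f 0 + q n ≤ b < f 0 + (q + 1)
  -- n = f (q n + n). So the maximum lies within one period above q n, and a search of n steps finds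
  -- it.
  residual-point : (f : Per n) (b : ℤ) → Σ ℤ λ a → fun f a ℤ.≤ b × ¬ fun f (1ℤ + a) ℤ.≤ b
  residual-point f b = lo + + j , proj₁ (proj₂ found) ,
    λ h → proj₂ (proj₂ found) (subst (λ x → fun f x ℤ.≤ b) (lem lo (+ j)) h)
    where
    q lo : ℤ
    q = (b - fun f 0ℤ) /ℕ n
    lo = q * + n
    P : ℕ → Set
    P j = fun f (lo + + j) ℤ.≤ b
    f-lo : fun f lo ≡ fun f 0ℤ + lo
    f-lo = trans (cong (fun f) (sym (ℤₚ.+-identityˡ lo))) (per-* f q 0ℤ)
    mv : ∀ b u v → b - u - v ≡ b - (u + v)
    mv = solve-∀
    mv′ : ∀ b u v → v - (1ℤ + (b - u)) ≡ u + v - (1ℤ + b)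
    mv′ = solve-∀
    lem : ∀ l j → 1ℤ + (l + j) ≡ l + (1ℤ + j)
    lem = solve-∀
    at-0 : P 0
    at-0 = subst (ℤ._≤ b) (trans (sym f-lo) (cong (fun f) (sym (ℤₚ.+-identityʳ lo))))
             (≤-move (mv b (fun f 0ℤ) lo) ([n/ℕd]*d≤n (b - fun f 0ℤ) n))
    f-hi : fun f (lo + + n) ≡ fun f 0ℤ + ℤ.suc q * + n
    f-hi = trans (per f lo) (trans (cong (_+ + n) f-lo) (lem′ (fun f 0ℤ) q (+ n)))
      where
      lem′ : ∀ u q n → u + q * n + n ≡ u + (1ℤ + q) * n
      lem′ = solve-∀
    at-n : ¬ P n
    at-n = 1+≤⇒≰ (subst (1ℤ + b ℤ.≤_) (sym f-hi)
             (≤-move (mv′ b (fun f 0ℤ) (ℤ.suc q * + n)) (ℤₚ.i<j⇒suc[i]≤j (n<s[n/ℕd]*d (b - fun f 0ℤ) n))))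
    found : Σ ℕ λ j → P j × ¬ P (suc j)
    found = boundary P (λ j → fun f (lo + + j) ℤ.≤? b) n at-0 at-n
    j : ℕ
    j = proj₁ found

  residual : Per n → ℤ → ℤ
  residual f b = proj₁ (residual-point f b)

  residual-adj : (f : Per n) → Adj (fun f) (residual f)
  residual-adj f a b = below-max (mono f) (proj₂ (residual-point f b)) , λ h → ℤₚ.≤-trans (mono f h) (proj₁ (proj₂ (residual-point f b)))

-- left and right name the operations ˡ and ʳ.
data Dir : Set where
  left right : Dir

Resid : Dir → (ℤ → ℤ) → (ℤ → ℤ) → Set
Resid left  f h = Adj h f
Resid right f g = Adj f g

resid-unique : ∀ d {f g g′} → Resid d f g → Resid d f g′ → g ≗ g′
resid-unique left  = adj-uniqueˡ
resid-unique right = adj-uniqueʳ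

resid-cong : ∀ d {f f′ g g′} → f ≗ f′ → g ≗ g′ → Resid d f g → Resid d f′ g′
resid-cong left  e e′ = adj-cong e′ e
resid-cong right e e′ = adj-cong e e′

resid-id : ∀ d → Resid d id id
resid-id left  = adj-id
resid-id right = adj-id

resid-∘ : ∀ d {f g f′ g′} → Resid d f g → Resid d f′ g′ → Resid d (f ∘ f′) (g′ ∘ g)
resid-∘ left  p q = adj-∘ q p
resid-∘ right p q = adj-∘ p q

resid-⊓ : ∀ d {f g f′ g′} → Resid d f g → Resid d f′ g′ → Resid d (λ x → f x ⊓ f′ x) (λ x → g x ⊔ g′ x)
resid-⊓ left  = adj-⊔⊓
resid-⊓ right = adj-⊓⊔

resid-⊔ : ∀ d {f g f′ g′} → Resid d f g → Resid d f′ g′ → Resid d (λ x → f x ⊔ f′ x) (λ x → g x ⊓ g′ x)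
resid-⊔ left  = adj-⊓⊔
resid-⊔ right = adj-⊔⊓

resid-+ : ∀ d c → Resid d (_+ c) (_- c)
resid-+ left  c = adj-cong (λ _ → refl) (λ x → cong (λ y → x + y) (ℤₚ.neg-involutive c)) (adj-+ (- c))
resid-+ right c = adj-+ c

resid-mono : ∀ d {f g} → Resid d f g → OrderPreserving g
resid-mono left  = adj-monoˡ
resid-mono right = adj-monoʳ

commutes-resid : ∀ d {f g c} → Resid d f g → Commutes f c → Commutes g c
commutes-resid left  = commutes-adjˡ
commutes-resid right = commutes-adjʳ

module _ {n : ℕ} .{{_ : NonZero n}} where

  residFun : Dir → Per n → ℤ → ℤ
  residFun left  f x = residual f (x - 1ℤ) + 1ℤ
  residFun right f   = residual f

  residFun-resid : ∀ d (f : Per n) → Resid d (fun f) (residFun d f)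
  residFun-resid left  f = adj-flipˡ (residual-adj f)
  residFun-resid right f = residual-adj f

  res : Dir → Per n → Per n
  res d f .fun  = residFun d f
  res d f .mono = resid-mono d (residFun-resid d f)
  res d f .per  = commutes-resid d (residFun-resid d f) (per f)

  res* : List Dir → Per n → Per n
  res* []       f = f
  res* (d ∷ ds) f = res d (res* ds f)

-- Validity of integer linear constraints

data Path {S : Set} (E : S → S → Set) (P : List S) : S → S → Set where
  edge : ∀ {a b} → E a b → Path E P a b
  via  : ∀ {a b c} → E a c → c ∈ P → Path E P c b → Path E P a b

module _ {S : Set} {E : S → S → Set} where

  path-weaken : ∀ {i is a b} → Path E is a b → Path E (i ∷ is) a b
  path-weaken (edge e)    = edge e
  path-weaken (via e m p) = via e (there m) (path-weaken p)

  path-join : ∀ {P a i b} → Path E P a i → i ∈ P → Path E P i b → Path E P a b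
  path-join (edge e)     i∈P q = via e i∈P q
  path-join (via e m p)  i∈P q = via e m (path-join p i∈P q)

  -- The path is cut at its first and its last visit to `i`, and everything between the two is
  -- discarded; neither remaining piece has `i` as an intermediate state.
  path-split : ∀ {i is a b} → Path E (i ∷ is) a b → Path E is a b ⊎ (Path E is a i × Path E is i b)
  path-split (edge e) = inj₁ (edge e)
  path-split (via e (here refl) p) with path-split p
  ... | inj₁ q       = inj₂ (edge e , q)
  ... | inj₂ (_ , q) = inj₂ (edge e , q)
  path-split (via e (there m) p) with path-split p
  ... | inj₁ q       = inj₁ (via e m q)
  ... | inj₂ (q , r) = inj₂ (via e m q , r)

  -- The Floyd–Warshall recursion on the set of permitted intermediate states.
  path? : (∀ a b → Dec (E a b)) → ∀ P a b → Dec (Path E P a b)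
  path? E? []       a b = map′ edge (λ { (edge e) → e }) (E? a b)
  path? E? (i ∷ is) a b =
    map′ [ path-weaken , (λ (p , q) → path-join (path-weaken p) (here refl) (path-weaken q)) ]′ path-split
         (path? E? is a b ⊎-dec (path? E? is a i ×-dec path? E? is i b))

vecs : {A : Set} → List A → (m : ℕ) → List (Vec A m)
vecs xs zero    = [] ∷ []
vecs xs (suc m) = cartesianProductWith _∷_ xs (vecs xs m)

∈-vecs : ∀ {A : Set} {xs : List A} {m} (v : Vec A m) → (∀ i → lookup v i ∈ xs) → v ∈ vecs xs m
∈-vecs []      h = here refl
∈-vecs (x ∷ v) h = ∈-cartesianProductWith⁺ _∷_ (h Fin.zero) (∈-vecs v (h ∘ Fin.suc))

-- The sum a + ⌊b / d⌋ is the floor of (a d + b) / d, and a floor is nonnegative exactly when the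
-- number itself is. With d = 2 this justifies reading one digit, with d = n the comparison of two
-- leaves.
floor-nonneg : ∀ d .{{_ : NonZero d}} a b → (0ℤ ℤ.≤ a * + d + b → 0ℤ ℤ.≤ a + b /ℕ d) × (0ℤ ℤ.≤ a + b /ℕ d → 0ℤ ℤ.≤ a * + d + b)
floor-nonneg d a b = to , from
  where
  q : ℤ
  q = b /ℕ d
  lem₁ : ∀ a q d → (1ℤ + (a + q)) * d ≡ a * d + (1ℤ + q) * d
  lem₁ = solve-∀
  lem₂ : ∀ a q d → (a + q) * d ≡ a * d + q * d
  lem₂ = solve-∀
  to : 0ℤ ℤ.≤ a * + d + b → 0ℤ ℤ.≤ a + q
  to h with 0ℤ ℤ.≤? a + q
  ... | yes p = p
  ... | no ¬p = ⊥-elim (ℤₚ.<⇒≱ (ℤₚ.<-≤-trans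
        (subst (a * + d + b ℤ.<_) (sym (lem₁ a q (+ d))) (ℤₚ.+-monoʳ-< (a * + d) (n<s[n/ℕd]*d b d)))
        (ℤₚ.*-monoʳ-≤-nonNeg (+ d) (≰⇒1+≤ ¬p))) h)
  from : 0ℤ ℤ.≤ a + q → 0ℤ ℤ.≤ a * + d + b
  from h = ℤₚ.≤-trans (ℤₚ.*-monoʳ-≤-nonNeg (+ d) h)
    (subst (ℤ._≤ a * + d + b) (sym (lem₂ a q (+ d))) (ℤₚ.+-monoʳ-≤ (a * + d) ([n/ℕd]*d≤n b d)))

-- The remainder is at most 1, so 2 |q| ≤ 2 M + 1, and integrality sharpens this to |q| ≤ M.
∣/2∣≤ : ∀ x M → ∣ x ∣ ℕ.≤ M ℕ.+ M → ∣ x /ℕ 2 ∣ ℕ.≤ M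
∣/2∣≤ x M h = ℕₚ.≤-pred (ℕₚ.*-cancelʳ-< 2 ∣ q ∣ (suc M) (begin-strict
  ∣ q ∣ ℕ.* 2            ≡⟨ ℤₚ.abs-* q (+ 2) ⟨
  ∣ q * + 2 ∣            ≡⟨ cong ∣_∣ q*2≡x-r ⟩
  ∣ x - + r ∣            ≤⟨ ℤₚ.∣i-j∣≤∣i∣+∣j∣ x (+ r) ⟩
  ∣ x ∣ ℕ.+ r            ≤⟨ ℕₚ.+-mono-≤ h (ℕₚ.≤-pred (n%ℕd<d x 2)) ⟩
  M ℕ.+ M ℕ.+ 1          <⟨ ℕₚ.≤-reflexive (cong suc (ℕₚ.+-comm (M ℕ.+ M) 1)) ⟩
  suc (suc (M ℕ.+ M))    ≡⟨ cong (suc ∘ suc) (trans (cong (M ℕ.+_) (sym (ℕₚ.+-identityʳ M))) (ℕₚ.*-comm 2 M)) ⟩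
  suc M ℕ.* 2            ∎))
  where
  open ℕₚ.≤-Reasoning
  q : ℤ
  q = x /ℕ 2
  r : ℕ
  r = x %ℕ 2
  lem : ∀ y r → y ≡ r + y - r
  lem = solve-∀
  q*2≡x-r : q * + 2 ≡ x - + r
  q*2≡x-r = trans (lem (q * + 2) (+ r)) (cong (_- + r) (sym (a≡a%ℕn+[a/ℕn]*n x 2)))

interval : ℕ → List ℤ
interval M = map +_ (upTo (suc M)) ++ map (λ j → - + j) (upTo (suc M))

∈-interval⁺ : ∀ {M} z → ∣ z ∣ ℕ.≤ M → z ∈ interval M
∈-interval⁺     (+ j)       h = ∈-++⁺ˡ (∈-map⁺ +_ (∈-upTo⁺ (ℕ.s≤s h)))
∈-interval⁺ {M} ℤ.-[1+ j ] h = ∈-++⁺ʳ (map +_ (upTo (suc M))) (∈-map⁺ (λ j → - + j) (∈-upTo⁺ (ℕ.s≤s h)))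

∈-interval⁻ : ∀ {M z} → z ∈ interval M → ∣ z ∣ ℕ.≤ M
∈-interval⁻ {M} z∈ with ∈-++⁻ (map +_ (upTo (suc M))) z∈
... | inj₁ p with ∈-map⁻ +_ p
...   | j , j∈ , refl = ℕₚ.≤-pred (∈-upTo⁻ j∈)
∈-interval⁻ {M} z∈ | inj₂ p with ∈-map⁻ (λ j → - + j) p
...   | j , j∈ , refl = ℕₚ.≤-trans (ℕₚ.≤-reflexive (ℤₚ.∣-i∣≡∣i∣ (+ j))) (ℕₚ.≤-pred (∈-upTo⁻ j∈))

-- Linear forms and signed binary digits

sg : Bool → ℤ → ℤ
sg true  x = x
sg false x = - x

sg-not : ∀ b x → sg (not b) x ≡ - sg b x
sg-not true  x = refl
sg-not false x = sym (ℤₚ.neg-involutive x)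

-- An integer coefficient is encoded by repeating a signed variable. The length of the list then
-- bounds the form on digit vectors.
Lin : ℕ → Set
Lin m = List (Bool × Fin m)

module _ {m : ℕ} where

  lin : Lin m → (Fin m → ℤ) → ℤ
  lin []            k = 0ℤ
  lin ((b , i) ∷ L) k = sg b (k i) + lin L k

  neg : Lin m → Lin m
  neg = map λ (b , i) → not b , i

  lin-neg : ∀ L k → lin (neg L) k ≡ - lin L k
  lin-neg []            k = refl
  lin-neg ((b , i) ∷ L) k = trans (cong₂ _+_ (sg-not b (k i)) (lin-neg L k)) (sym (ℤₚ.neg-distrib-+ (sg b (k i)) (lin L k)))

  lin-++ : ∀ L L′ k → lin (L ++ L′) k ≡ lin L k + lin L′ k
  lin-++ []            L′ k = sym (ℤₚ.+-identityˡ (lin L′ k))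
  lin-++ ((b , i) ∷ L) L′ k = trans (cong (λ y → sg b (k i) + y) (lin-++ L L′ k)) (sym (ℤₚ.+-assoc (sg b (k i)) (lin L k) (lin L′ k)))

  lin-cong : ∀ L {k k′} → k ≗ k′ → lin L k ≡ lin L k′
  lin-cong []            h = refl
  lin-cong ((b , i) ∷ L) h = cong₂ _+_ (cong (sg b) (h i)) (lin-cong L h)

  lin-digits : ∀ L {k k′ e} → (∀ i → k i ≡ k′ i * + 2 + e i) → lin L k ≡ lin L k′ * + 2 + lin L e
  lin-digits []                    h = refl
  lin-digits ((b , i) ∷ L) {k} {k′} {e} h =
    trans (cong₂ _+_ (trans (cong (sg b) (h i)) (sg-digits b)) (lin-digits L h))
          (lem (sg b (k′ i)) (sg b (e i)) (lin L k′) (lin L e))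
    where
    lem : ∀ a b c d → a * + 2 + b + (c * + 2 + d) ≡ (a + c) * + 2 + (b + d)
    lem = solve-∀
    lem′ : ∀ a b → - (a * + 2 + b) ≡ - a * + 2 - b
    lem′ = solve-∀
    sg-digits : ∀ b → sg b (k′ i * + 2 + e i) ≡ sg b (k′ i) * + 2 + sg b (e i)
    sg-digits true  = refl
    sg-digits false = lem′ (k′ i) (e i)

  ∣lin∣≤length : ∀ L {e} → (∀ i → ∣ e i ∣ ℕ.≤ 1) → ∣ lin L e ∣ ℕ.≤ length L
  ∣lin∣≤length []            h = ℕ.z≤n
  ∣lin∣≤length ((b , i) ∷ L) {e} h = ℕₚ.≤-trans (ℤₚ.∣i+j∣≤∣i∣+∣j∣ (sg b (e i)) (lin L e))
    (ℕₚ.+-mono-≤ (∣sg∣ b) (∣lin∣≤length L h))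
    where
    ∣sg∣ : ∀ b → ∣ sg b (e i) ∣ ℕ.≤ 1
    ∣sg∣ true  = h i
    ∣sg∣ false = ℕₚ.≤-trans (ℕₚ.≤-reflexive (ℤₚ.∣-i∣≡∣i∣ (e i))) (h i)

data Digit : Set where
  -1ᵈ 0ᵈ 1ᵈ : Digit

digits : List Digit
digits = -1ᵈ ∷ 0ᵈ ∷ 1ᵈ ∷ []

∈-digits : ∀ d → d ∈ digits
∈-digits -1ᵈ = here refl
∈-digits 0ᵈ  = there (here refl)
∈-digits 1ᵈ  = there (there (here refl))

⟦_⟧ᵈ : Digit → ℤ
⟦ -1ᵈ ⟧ᵈ = ℤ.-1ℤ
⟦ 0ᵈ ⟧ᵈ  = 0ℤ
⟦ 1ᵈ ⟧ᵈ  = 1ℤ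

∣digit∣≤1 : ∀ d → ∣ ⟦ d ⟧ᵈ ∣ ℕ.≤ 1
∣digit∣≤1 -1ᵈ = ℕₚ.≤-refl
∣digit∣≤1 0ᵈ  = ℕ.z≤n
∣digit∣≤1 1ᵈ  = ℕₚ.≤-refl

-- With signed digits, repeated halving of any integer ends in 0 (with digits 0 and 1 it would stay at −1).
record Halving (z : ℤ) : Set where
  constructor halving
  field
    half    : ℤ
    digit   : Digit
    eq      : z ≡ half * + 2 + ⟦ digit ⟧ᵈ
    shrinks : ∀ {B} → ∣ z ∣ ℕ.≤ suc B → ∣ half ∣ ℕ.≤ B

halve : ∀ z → Halving z
halve (+ zero)        = halving 0ℤ 0ᵈ refl λ _ → ℕ.z≤n
halve (+ suc zero)    = halving 0ℤ 1ᵈ refl λ _ → ℕ.z≤n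
halve (+ suc (suc j)) with halve (+ j)
... | halving h d eq s = halving (1ℤ + h) d (trans (cong (λ y → + 2 + y) eq) (lem h ⟦ d ⟧ᵈ))
        (λ { {suc B} (ℕ.s≤s (ℕ.s≤s p)) → ℕₚ.≤-trans (ℤₚ.∣i+j∣≤∣i∣+∣j∣ 1ℤ h) (ℕ.s≤s (s (ℕₚ.m≤n⇒m≤1+n p))) })
  where
  lem : ∀ h d → + 2 + (h * + 2 + d) ≡ (1ℤ + h) * + 2 + d
  lem = solve-∀
halve ℤ.-[1+ zero ]        = halving 0ℤ -1ᵈ refl λ _ → ℕ.z≤n
halve ℤ.-[1+ suc zero ]    = halving ℤ.-1ℤ 0ᵈ refl λ p → ℕₚ.≤-pred p
halve ℤ.-[1+ suc (suc j) ] with halve ℤ.-[1+ j ]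
... | halving h d eq s = halving (ℤ.-1ℤ + h) d (trans (cong (λ y → - + 2 + y) eq) (lem h ⟦ d ⟧ᵈ))
        (λ { {suc B} (ℕ.s≤s (ℕ.s≤s p)) → ℕₚ.≤-trans (ℤₚ.∣i+j∣≤∣i∣+∣j∣ ℤ.-1ℤ h) (ℕ.s≤s (s (ℕₚ.m≤n⇒m≤1+n p))) })
  where
  lem : ∀ h d → - + 2 + (h * + 2 + d) ≡ (ℤ.-1ℤ + h) * + 2 + d
  lem = solve-∀

-- The automaton of a positive Boolean combination of inequalities

data Form (m : ℕ) : Set where
  atom     : Lin m → Form m
  _and_ _or_ : Form m → Form m → Form m

-- One additive constant per atom; these are the states of the automaton that reads the signed binary
-- digits of the variables, least significant first.
Consts : ∀ {m} → Form m → Set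
Consts (atom L)  = ℤ
Consts (φ and ψ) = Consts φ × Consts ψ
Consts (φ or ψ)  = Consts φ × Consts ψ

module _ {m : ℕ} where

  Holds : (φ : Form m) → Consts φ → (Fin m → ℤ) → Set
  Holds (atom L)  c       k = 0ℤ ℤ.≤ lin L k + c
  Holds (φ and ψ) (c , d) k = Holds φ c k × Holds ψ d k
  Holds (φ or ψ)  (c , d) k = Holds φ c k ⊎ Holds ψ d k

  holds? : ∀ φ c k → Dec (Holds φ c k)
  holds? (atom L)  c       k = 0ℤ ℤ.≤? lin L k + c
  holds? (φ and ψ) (c , d) k = holds? φ c k ×-dec holds? ψ d k
  holds? (φ or ψ)  (c , d) k = holds? φ c k ⊎-dec holds? ψ d k

  holds-cong : ∀ φ {c k k′} → k ≗ k′ → Holds φ c k → Holds φ c k′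
  holds-cong (atom L)  {c} h p        = subst (λ y → 0ℤ ℤ.≤ y + c) (lin-cong L h) p
  holds-cong (φ and ψ) h (p , q)  = holds-cong φ h p , holds-cong ψ h q
  holds-cong (φ or ψ)  h (inj₁ p) = inj₁ (holds-cong φ h p)
  holds-cong (φ or ψ)  h (inj₂ q) = inj₂ (holds-cong ψ h q)

  consts-≟ : (φ : Form m) → DecidableEquality (Consts φ)
  consts-≟ (atom L)  = ℤ._≟_
  consts-≟ (φ and ψ) = ≡-dec (consts-≟ φ) (consts-≟ ψ)
  consts-≟ (φ or ψ)  = ≡-dec (consts-≟ φ) (consts-≟ ψ)

  step : (φ : Form m) → (Fin m → ℤ) → Consts φ → Consts φ
  step (atom L)  e c       = (lin L e + c) /ℕ 2
  step (φ and ψ) e (c , d) = step φ e c , step ψ e d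
  step (φ or ψ)  e (c , d) = step φ e c , step ψ e d

  module _ {k k′ e : Fin m → ℤ} (k≡ : ∀ i → k i ≡ k′ i * + 2 + e i) where

    atom-digits : ∀ L c → lin L k + c ≡ lin L k′ * + 2 + (lin L e + c)
    atom-digits L c = trans (cong (_+ c) (lin-digits L k≡)) (ℤₚ.+-assoc (lin L k′ * + 2) (lin L e) c)

    holds-step⁺ : ∀ φ c → Holds φ c k → Holds φ (step φ e c) k′
    holds-step⁺ (atom L)  c p = proj₁ (floor-nonneg 2 (lin L k′) (lin L e + c)) (subst (0ℤ ℤ.≤_) (atom-digits L c) p)
    holds-step⁺ (φ and ψ) (c , d) (p , q)  = holds-step⁺ φ c p , holds-step⁺ ψ d q
    holds-step⁺ (φ or ψ)  (c , d) (inj₁ p) = inj₁ (holds-step⁺ φ c p)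
    holds-step⁺ (φ or ψ)  (c , d) (inj₂ q) = inj₂ (holds-step⁺ ψ d q)

    holds-step⁻ : ∀ φ c → Holds φ (step φ e c) k′ → Holds φ c k
    holds-step⁻ (atom L)  c p = subst (0ℤ ℤ.≤_) (sym (atom-digits L c)) (proj₂ (floor-nonneg 2 (lin L k′) (lin L e + c)) p)
    holds-step⁻ (φ and ψ) (c , d) (p , q)  = holds-step⁻ φ c p , holds-step⁻ ψ d q
    holds-step⁻ (φ or ψ)  (c , d) (inj₁ p) = inj₁ (holds-step⁻ φ c p)
    holds-step⁻ (φ or ψ)  (c , d) (inj₂ q) = inj₂ (holds-step⁻ ψ d q)

  -- The bound dominates both the initial constant and every digit sum. Half of a digit sum plus a
  -- constant within the bound is again within it, so the automaton never leaves the box.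
  box : (φ : Form m) → Consts φ → List (Consts φ)
  box (atom L)  c       = interval (∣ c ∣ ℕ.+ length L)
  box (φ and ψ) (c , d) = cartesianProduct (box φ c) (box ψ d)
  box (φ or ψ)  (c , d) = cartesianProduct (box φ c) (box ψ d)

  start∈box : ∀ φ c → c ∈ box φ c
  start∈box (atom L)  c       = ∈-interval⁺ c (ℕₚ.m≤m+n ∣ c ∣ (length L))
  start∈box (φ and ψ) (c , d) = ∈-cartesianProduct⁺ (start∈box φ c) (start∈box ψ d)
  start∈box (φ or ψ)  (c , d) = ∈-cartesianProduct⁺ (start∈box φ c) (start∈box ψ d)

  step∈box : ∀ φ {c₀ c e} → (∀ i → ∣ e i ∣ ℕ.≤ 1) → c ∈ box φ c₀ → step φ e c ∈ box φ c₀
  step∈box (atom L) {c₀} {c} {e} h p = ∈-interval⁺ _ (∣/2∣≤ (lin L e + c) M (ℕₚ.≤-trans (ℤₚ.∣i+j∣≤∣i∣+∣j∣ (lin L e) c)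
    (ℕₚ.+-mono-≤ (ℕₚ.≤-trans (∣lin∣≤length L h) (ℕₚ.m≤n+m (length L) ∣ c₀ ∣)) (∈-interval⁻ {M} p))))
    where
    M : ℕ
    M = ∣ c₀ ∣ ℕ.+ length L
  step∈box (φ and ψ) {c₀ , d₀} h p with ∈-cartesianProduct⁻ (box φ c₀) (box ψ d₀) p
  ... | q , r = ∈-cartesianProduct⁺ (step∈box φ h q) (step∈box ψ h r)
  step∈box (φ or ψ) {c₀ , d₀} h p with ∈-cartesianProduct⁻ (box φ c₀) (box ψ d₀) p
  ... | q , r = ∈-cartesianProduct⁺ (step∈box φ h q) (step∈box ψ h r)

  ⟦_⟧ᵉ : Vec Digit m → Fin m → ℤ
  ⟦ e ⟧ᵉ i = ⟦ lookup e i ⟧ᵈ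

  module _ (φ : Form m) (c₀ : Consts φ) where

    Edge : Consts φ → Consts φ → Set
    Edge c c′ = Any (λ e → step φ ⟦ e ⟧ᵉ c ≡ c′) (vecs digits m)

    Fails : Consts φ → Set
    Fails c = Σ (Fin m → ℤ) λ k → ¬ Holds φ c k

    FailsAt0 : Consts φ → Set
    FailsAt0 c = ¬ Holds φ c (λ _ → 0ℤ)

    -- When all digits have been read the remaining arguments are 0, so failure at 0 is the
    -- accepting condition. A `Path` has at least one edge; the first alternative stands for the
    -- empty path.
    Escapes : Consts φ → Set
    Escapes c = FailsAt0 c ⊎ Any (λ b → FailsAt0 b × Path Edge (box φ c₀) c b) (box φ c₀)

    escapes? : ∀ c → Dec (Escapes c)
    escapes? c = failsAt0? c ⊎-dec any? (λ b → failsAt0? b ×-dec path? edge? (box φ c₀) c b) (box φ c₀)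
      where
      failsAt0? : ∀ c → Dec (FailsAt0 c)
      failsAt0? c = ¬? (holds? φ c (λ _ → 0ℤ))
      edge? : ∀ c c′ → Dec (Edge c c′)
      edge? c c′ = any? (λ e → consts-≟ φ (step φ ⟦ e ⟧ᵉ c) c′) (vecs digits m)

    -- Going back along an edge appends a least significant digit to each component of the
    -- counterexample.
    edge-fails : ∀ {c c′} → Edge c c′ → Fails c′ → Fails c
    edge-fails {c} e (k , ¬h) with find e
    ... | d , _ , refl = (λ i → k i * + 2 + ⟦ d ⟧ᵉ i) , ¬h ∘ holds-step⁺ (λ _ → refl) φ c

    path-fails : ∀ {c b} → Path Edge (box φ c₀) c b → Fails b → Fails c
    path-fails (edge e)    h = edge-fails e h
    path-fails (via e _ p) h = edge-fails e (path-fails p h)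

    escapes⇒fails : ∀ {c} → Escapes c → Fails c
    escapes⇒fails (inj₁ h) = (λ _ → 0ℤ) , h
    escapes⇒fails (inj₂ a) with find a
    ... | _ , _ , h , p = path-fails p ((λ _ → 0ℤ) , h)

    -- The digits of a counterexample trace a path. The bound `B` on its entries drops with every
    -- halving, and at `B` = 0 the counterexample is the zero vector. The box stays that of the
    -- start state `c₀` while `c` moves.
    fails⇒escapes : ∀ B {c} → c ∈ box φ c₀ → ∀ k → (∀ i → ∣ k i ∣ ℕ.≤ B) → ¬ Holds φ c k → Escapes c
    fails⇒escapes zero c∈ k k≤0 ¬h = inj₁ (¬h ∘ holds-cong φ (λ i → sym (ℤₚ.∣i∣≡0⇒i≡0 (ℕₚ.n≤0⇒n≡0 (k≤0 i)))))
    fails⇒escapes (suc B) {c} c∈ k k≤ ¬h = [ direct , further ]′ rest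
      where
      open Halving
      d : Vec Digit m
      d = tabulate (λ i → digit (halve (k i)))
      k′ : Fin m → ℤ
      k′ i = half (halve (k i))
      k≡ : ∀ i → k i ≡ k′ i * + 2 + ⟦ d ⟧ᵉ i
      k≡ i = trans (eq (halve (k i))) (cong (λ y → k′ i * + 2 + ⟦ y ⟧ᵈ) (sym (lookup∘tabulate _ i)))
      c′ : Consts φ
      c′ = step φ ⟦ d ⟧ᵉ c
      c′∈ : c′ ∈ box φ c₀
      c′∈ = step∈box φ (λ i → ∣digit∣≤1 (lookup d i)) c∈
      e : Edge c c′
      e = lose (∈-vecs d (λ i → ∈-digits (lookup d i))) refl
      rest : Escapes c′
      rest = fails⇒escapes B c′∈ k′ (λ i → shrinks (halve (k i)) (k≤ i)) (¬h ∘ holds-step⁻ k≡ φ c)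
      direct : FailsAt0 c′ → Escapes c
      direct h = inj₂ (lose c′∈ (h , edge e))
      further : Any (λ b → FailsAt0 b × Path Edge (box φ c₀) c′ b) (box φ c₀) → Escapes c
      further a with find a
      ... | b , b∈ , h , p = inj₂ (lose b∈ (h , via e c′∈ p))

  bounded : ∀ {m} (k : Fin m → ℤ) → Σ ℕ λ B → ∀ i → ∣ k i ∣ ℕ.≤ B
  bounded {zero}  k = 0 , λ ()
  bounded {suc m} k with bounded (k ∘ Fin.suc)
  ... | B , h = ∣ k Fin.zero ∣ ℕ.+ B , λ
    { Fin.zero → ℕₚ.m≤m+n ∣ k Fin.zero ∣ B
    ; (Fin.suc i) → ℕₚ.≤-trans (h i) (ℕₚ.m≤n+m B ∣ k Fin.zero ∣) }

  always? : ∀ φ c → Dec (∀ k → Holds φ c k)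
  always? φ c with escapes? φ c c
  ... | yes p = no λ h → proj₂ (escapes⇒fails φ c p) (h _)
  -- The search only rules out counterexamples; as `Holds` is decidable at each `k`, this yields
  -- `Holds` itself.
  ... | no ¬p = yes λ k → decidable-stable (holds? φ c k) λ ¬h →
                  ¬p (fails⇒escapes φ c (proj₁ (bounded k)) (start∈box φ c) k (proj₂ (bounded k)) ¬h)

-- Periodic maps and terms

-- By adj-flipʳ, each step trades a left residual for a right one at the price of a conjugation by the successor map.
residual-chains : ∀ {L R : ℕ → ℤ → ℤ} → (∀ k → Adj (L (suc k)) (L k)) → (∀ k → Adj (R k) (R (suc k))) →
  L 0 ≗ R 0 → ∀ k → R k ≗ λ x → L k (x + + k) - + k
residual-chains {L} l r e zero x = trans (sym (e x)) (sym (trans (ℤₚ.+-identityʳ _) (cong (L 0) (ℤₚ.+-identityʳ x))))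
residual-chains {L} {R} l r e (suc k) x =
  trans (adj-uniqueʳ (r k) conj x) (trans (cong (λ y → L (suc k) y - 1ℤ - + k) (lem₁ x (+ k))) (lem₂ (L (suc k) (x + + suc k)) (+ k)))
  where
  lem₁ : ∀ x k → x - - k + 1ℤ ≡ x + (1ℤ + k)
  lem₁ = solve-∀
  lem₂ : ∀ y k → y - 1ℤ - k ≡ y - (1ℤ + k)
  lem₂ = solve-∀
  conj : Adj (R k) (λ x → L (suc k) (x - - + k + 1ℤ) - 1ℤ - + k)
  conj = adj-cong (λ x → sym (residual-chains l r e k x)) (λ _ → refl)
           (adj-∘ (adj-+ (- + k)) (adj-∘ (adj-flipʳ (l k)) (adj-+ (+ k))))

module _ {n : ℕ} where

  fromFn : Fn n → Per n
  fromFn F = record { fun = Fn.fun F ; mono = Fn.mono F ; per = λ x → trans (sym (l0 _)) (trans (lseq-per x) (cong (_+ + n) (l0 x))) }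
    where
    open Fn F using (rseq; lseq; r0; l0; rres; lres; eqn)
    -- Monotonicity is given for `fun` only. A monotone `lseq k` turns the dual residual property
    -- into an adjunction, which in turn makes `lseq (suc k)` monotone, so both are proved by one
    -- induction.
    ladj : ∀ k → Adj (lseq (suc k)) (lseq k)
    lmono : ∀ k → OrderPreserving (lseq k)
    ladj k = isDualResidual⇒adj (lmono k) (lres k)
    lmono zero {a} {b} a≤b = subst₂ ℤ._≤_ (sym (l0 a)) (sym (l0 b)) (Fn.mono F a≤b)
    lmono (suc k) = adj-monoˡ (ladj k)
    radj : ∀ k → Adj (rseq k) (rseq (suc k))
    rmono : ∀ k → OrderPreserving (rseq k)
    radj k = isResidual⇒adj (rmono k) (rres k)
    rmono zero {a} {b} a≤b = subst₂ ℤ._≤_ (sym (r0 a)) (sym (r0 b)) (Fn.mono F a≤b)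
    rmono (suc k) = adj-monoʳ (radj k)
    lem : ∀ y c → y ≡ y - c + c
    lem = solve-∀
    -- At level `n` the two chains differ by conjugation with translation by `n`, so `eqn` says that
    -- `lseq n x` equals `lseq n (x + n) - n`.
    lseq-n : Commutes (lseq n) (+ n)
    lseq-n x = trans (lem _ (+ n)) (cong (_+ + n) (sym (trans (eqn x)
      (residual-chains ladj radj (λ x → trans (l0 x) (sym (r0 x))) n x))))
    -- Each `lseq k` is the right adjoint of `lseq (suc k)`, so commuting with the translation
    -- passes down to level 0, which is `fun`.
    descend : ∀ k → Commutes (lseq k) (+ n) → Commutes (lseq 0) (+ n)
    descend zero    h = h
    descend (suc k) h = descend k (commutes-adjʳ (ladj k) h)
    lseq-per : Commutes (lseq 0) (+ n)
    lseq-per = descend n lseq-n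

  perId : Per n
  perId = record { fun = id ; mono = id ; per = λ _ → refl }

  perMul perMeet perJoin : Per n → Per n → Per n
  perMul f g = record
    { fun = fun f ∘ fun g ; mono = mono f ∘ mono g
    ; per = λ x → trans (cong (fun f) (per g x)) (per f (fun g x)) }
  perMeet f g = record
    { fun = λ x → fun f x ⊓ fun g x ; mono = λ p → ℤₚ.⊓-mono-≤ (mono f p) (mono g p)
    ; per = λ x → trans (cong₂ _⊓_ (per f x) (per g x)) (sym (ℤₚ.mono-≤-distrib-⊓ (ℤₚ.+-monoˡ-≤ (+ n)) (fun f x) (fun g x))) }
  perJoin f g = record
    { fun = λ x → fun f x ⊔ fun g x ; mono = λ p → ℤₚ.⊔-mono-≤ (mono f p) (mono g p)
    ; per = λ x → trans (cong₂ _⊔_ (per f x) (per g x)) (sym (ℤₚ.mono-≤-distrib-⊔ (ℤₚ.+-monoˡ-≤ (+ n)) (fun f x) (fun g x))) }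

  perShift : ℤ → Per n → Per n
  perShift k f = record
    { fun = λ x → fun f x + k * + n ; mono = λ p → ℤₚ.+-monoˡ-≤ (k * + n) (mono f p)
    ; per = λ x → trans (cong (_+ k * + n) (per f x)) (lem (fun f x) (k * + n) (+ n)) }
    where
    lem : ∀ x y z → x + z + y ≡ x + y + z
    lem = solve-∀

-- Normal forms of terms and their min-max trees

bound : Term → ℕ
bound (var i) = suc i
bound one     = 0
bound (s · t) = bound s ℕ.⊔ bound t
bound (s ∧ t) = bound s ℕ.⊔ bound t
bound (s ∨ t) = bound s ℕ.⊔ bound t
bound (t ˡ)   = bound t
bound (t ʳ)   = bound t

boundˡ : ∀ s t {m} → bound s ℕ.⊔ bound t ℕ.≤ m → bound s ℕ.≤ m
boundˡ s t = ℕₚ.m⊔n≤o⇒m≤o (bound s) (bound t)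

boundʳ : ∀ s t {m} → bound s ℕ.⊔ bound t ℕ.≤ m → bound t ℕ.≤ m
boundʳ s t = ℕₚ.m⊔n≤o⇒n≤o (bound s) (bound t)

-- Terms with all residuals pushed to the variables; the list of directions has the outermost residual first.
data NTerm (m : ℕ) : Set where
  lit            : Fin m → List Dir → NTerm m
  unit           : NTerm m
  mul meet join  : NTerm m → NTerm m → NTerm m

push : ∀ {m} → Dir → NTerm m → NTerm m
push d (lit i ds) = lit i (d ∷ ds)
push d unit       = unit
push d (mul s t)  = mul (push d t) (push d s)
push d (meet s t) = join (push d s) (push d t)
push d (join s t) = meet (push d s) (push d t)

module _ {m : ℕ} where

  norm : ∀ t → bound t ℕ.≤ m → NTerm m
  norm (var i) p = lit (fromℕ< p) []
  norm one     p = unit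
  norm (s · t) p = mul (norm s (boundˡ s t p)) (norm t (boundʳ s t p))
  norm (s ∧ t) p = meet (norm s (boundˡ s t p)) (norm t (boundʳ s t p))
  norm (s ∨ t) p = join (norm s (boundˡ s t p)) (norm t (boundʳ s t p))
  norm (t ˡ)   p = push left (norm t p)
  norm (t ʳ)   p = push right (norm t p)

data Tree (m : ℕ) : Set where
  leaf    : Lin m → ℤ → Tree m
  min max : Tree m → Tree m → Tree m

graft : ∀ {m} → Tree m → (Lin m → ℤ → Tree m) → Tree m
graft (leaf L c) F = F L c
graft (min τ σ)  F = min (graft τ F) (graft σ F)
graft (max τ σ)  F = max (graft τ F) (graft σ F)

-- Every residual inverts a translation, so this is the sign with which a translation length
-- survives a chain of residuals.
parity : List Dir → Bool
parity []       = true
parity (d ∷ ds) = not (parity ds)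

module _ {n : ℕ} .{{_ : NonZero n}} where

  -- Residuals of periodic maps are periodic again, so they can be iterated to all orders. For
  -- `eqn`, the two chains differ at level `n` by conjugation with translation by `n`, which fixes
  -- every periodic map.
  toFn : Per n → Fn n
  toFn f = record
    { fun = fun f ; mono = mono f
    ; rseq = R ; lseq = L ; r0 = λ _ → refl ; l0 = λ _ → refl
    ; rres = λ k → adj⇒isResidual (radj k)
    ; lres = λ k → adj⇒isDualResidual (ladj k)
    ; eqn  = λ x → sym (trans (residual-chains ladj radj (λ _ → refl) n x)
               (trans (cong (_- + n) (per (iter left n) x)) (lem (L n x) (+ n)))) }
    where
    iter : Dir → ℕ → Per n
    iter d k = res* (replicate k d) f
    L R : ℕ → ℤ → ℤ
    L = fun ∘ iter left
    R = fun ∘ iter right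
    ladj : ∀ k → Adj (L (suc k)) (L k)
    ladj k = residFun-resid left (iter left k)
    radj : ∀ k → Adj (R k) (R (suc k))
    radj k = residFun-resid right (iter right k)
    lem : ∀ y c → y + c - c ≡ y
    lem = solve-∀

  module _ {m : ℕ} where

    ⟦_⟧ : NTerm m → (Fin m → Per n) → Per n
    ⟦ lit i ds ⟧ γ = res* ds (γ i)
    ⟦ unit ⟧     γ = perId
    ⟦ mul s t ⟧  γ = perMul (⟦ s ⟧ γ) (⟦ t ⟧ γ)
    ⟦ meet s t ⟧ γ = perMeet (⟦ s ⟧ γ) (⟦ t ⟧ γ)
    ⟦ join s t ⟧ γ = perJoin (⟦ s ⟧ γ) (⟦ t ⟧ γ)

    push-resid : ∀ d t γ → Resid d (fun (⟦ t ⟧ γ)) (fun (⟦ push d t ⟧ γ))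
    push-resid d (lit i ds) γ = residFun-resid d (res* ds (γ i))
    push-resid d unit       γ = resid-id d
    push-resid d (mul s t)  γ = resid-∘ d (push-resid d s γ) (push-resid d t γ)
    push-resid d (meet s t) γ = resid-⊓ d (push-resid d s γ) (push-resid d t γ)
    push-resid d (join s t) γ = resid-⊔ d (push-resid d s γ) (push-resid d t γ)

    module _ {ρ : ℕ → Fn n} {γ : Fin m → Per n} (ρ≗γ : ∀ {i} (p : i ℕ.< m) → Fn.fun (ρ i) ≗ fun (γ (fromℕ< p))) where

      mono-≗ : ∀ {f} (g : Per n) → f ≗ fun g → OrderPreserving f
      mono-≗ g e {a} {b} a≤b = subst₂ ℤ._≤_ (sym (e a)) (sym (e b)) (mono g a≤b)

      -- `Eval` accepts any function that meets the specification of a residual; uniqueness of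
      -- adjoints identifies it with the computed one.
      eval-norm : ∀ {t f} → Eval ρ t f → (p : bound t ℕ.≤ m) → f ≗ fun (⟦ norm t p ⟧ γ)
      eval-norm (ev-var i) p = ρ≗γ p
      eval-norm ev-one     p x = refl
      eval-norm (ev-mul {s} {t} {f} {g} u v) p x =
        trans (eval-norm u _ (g x)) (cong (fun (⟦ norm s _ ⟧ γ)) (eval-norm v _ x))
      eval-norm (ev-meet u v) p x = cong₂ _⊓_ (eval-norm u _ x) (eval-norm v _ x)
      eval-norm (ev-join u v) p x = cong₂ _⊔_ (eval-norm u _ x) (eval-norm v _ x)
      eval-norm (ev-l {t} u h) p = resid-unique left
        (resid-cong left (eval-norm u p) (λ _ → refl) (isDualResidual⇒adj (mono-≗ (⟦ norm t p ⟧ γ) (eval-norm u p)) h))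
        (push-resid left (norm t p) γ)
      eval-norm (ev-r {t} u h) p = resid-unique right
        (resid-cong right (eval-norm u p) (λ _ → refl) (isResidual⇒adj (mono-≗ (⟦ norm t p ⟧ γ) (eval-norm u p)) h))
        (push-resid right (norm t p) γ)

      -- `Valid` speaks only about evaluations that are supplied to it, so extracting information
      -- from it requires evaluations to exist.
      eval-exists : ∀ t → bound t ℕ.≤ m → Σ (ℤ → ℤ) (Eval ρ t)
      eval-exists (var i) p = _ , ev-var i
      eval-exists one     p = _ , ev-one
      eval-exists (s · t) p = _ , ev-mul (proj₂ (eval-exists s (boundˡ s t p))) (proj₂ (eval-exists t (boundʳ s t p)))
      eval-exists (s ∧ t) p = _ , ev-meet (proj₂ (eval-exists s (boundˡ s t p))) (proj₂ (eval-exists t (boundʳ s t p)))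
      eval-exists (s ∨ t) p = _ , ev-join (proj₂ (eval-exists s (boundˡ s t p))) (proj₂ (eval-exists t (boundʳ s t p)))
      eval-exists (t ˡ)   p with eval-exists t p
      ... | f , u = _ , ev-l u (adj⇒isDualResidual (resid-cong left (sym ∘ eval-norm u p) (λ _ → refl) (push-resid left (norm t p) γ)))
      eval-exists (t ʳ)   p with eval-exists t p
      ... | f , u = _ , ev-r u (adj⇒isResidual (resid-cong right (sym ∘ eval-norm u p) (λ _ → refl) (push-resid right (norm t p) γ)))

  -- Here `f` is `g` followed by a translation; its residual is the inverse translation followed by
  -- the residual of `g`, and periodicity moves that translation outside.
  res-shift : ∀ d (f g : Per n) q → (∀ x → fun f x ≡ fun g x + q * + n) → ∀ x → residFun d f x ≡ residFun d g x - q * + n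
  res-shift d f g q e x = trans
    (resid-unique d (residFun-resid d f)
      (resid-cong d (sym ∘ e) (λ _ → refl) (resid-∘ d (resid-+ d (q * + n)) (residFun-resid d g))) x)
    (commutes-neg (residFun d g) (per-* (res d g) q) x)

  res*-shift : ∀ ds (f g : Per n) k → (∀ x → fun f x ≡ fun g x + k * + n) →
    ∀ x → fun (res* ds f) x ≡ fun (res* ds g) x + sg (parity ds) k * + n
  res*-shift []       f g k e x = e x
  res*-shift (d ∷ ds) f g k e x = trans
    (res-shift d (res* ds f) (res* ds g) (sg (parity ds) k) (res*-shift ds f g k e) x)
    (cong (λ y → residFun d (res* ds g) x + y) (trans (ℤₚ.neg-distribˡ-* (sg (parity ds) k) (+ n))
      (cong (_* + n) (sym (sg-not (parity ds) k)))))

  module _ {m : ℕ} where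

    val : Tree m → (Fin m → ℤ) → ℤ
    val (leaf L c) k = lin L k * + n + c
    val (min τ σ)  k = val τ k ⊓ val σ k
    val (max τ σ)  k = val τ k ⊔ val σ k

    -- The value of t at the point L · n + c when the i-th variable is g i followed by translation by k i · n,
    -- as an expression in the unknown translation lengths k.
    tree : (Fin m → Per n) → NTerm m → Lin m → ℤ → Tree m
    tree g (lit i ds) L c = leaf ((parity ds , i) ∷ L) (fun (res* ds (g i)) c)
    tree g unit       L c = leaf L c
    tree g (mul s t)  L c = graft (tree g t L c) (tree g s)
    tree g (meet s t) L c = min (tree g s L c) (tree g t L c)
    tree g (join s t) L c = max (tree g s L c) (tree g t L c)

    -- A monotone map of a chain preserves binary minima and maxima, so it may be applied leaf by
    -- leaf.
    val-graft : ∀ {f k F} → OrderPreserving f → (∀ L c → val (F L c) k ≡ f (lin L k * + n + c)) →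
      ∀ τ → val (graft τ F) k ≡ f (val τ k)
    val-graft mf e (leaf L c) = e L c
    val-graft {k = k} mf e (min τ σ) = trans (cong₂ _⊓_ (val-graft mf e τ) (val-graft mf e σ)) (sym (ℤₚ.mono-≤-distrib-⊓ mf (val τ k) (val σ k)))
    val-graft {k = k} mf e (max τ σ) = trans (cong₂ _⊔_ (val-graft mf e τ) (val-graft mf e σ)) (sym (ℤₚ.mono-≤-distrib-⊔ mf (val τ k) (val σ k)))

    val-tree : ∀ {γ g : Fin m → Per n} {k} → (∀ i x → fun (γ i) x ≡ fun (g i) x + k i * + n) →
      ∀ t L c → val (tree g t L c) k ≡ fun (⟦ t ⟧ γ) (lin L k * + n + c)
    val-tree {γ} {g} {k} e (lit i ds) L c = sym (begin
      fun F (lin L k * + n + c)                                         ≡⟨ cong (fun F) (ℤₚ.+-comm (lin L k * + n) c) ⟩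
      fun F (c + lin L k * + n)                                         ≡⟨ per-* F (lin L k) c ⟩
      fun F c + lin L k * + n                                           ≡⟨ cong (_+ lin L k * + n) (res*-shift ds (γ i) (g i) (k i) (e i) c) ⟩
      fun (res* ds (g i)) c + sg (parity ds) (k i) * + n + lin L k * + n ≡⟨ lem (fun (res* ds (g i)) c) (sg (parity ds) (k i)) (lin L k) (+ n) ⟩
      (sg (parity ds) (k i) + lin L k) * + n + fun (res* ds (g i)) c     ∎)
      where
      open ≡-Reasoning
      F : Per n
      F = res* ds (γ i)
      lem : ∀ y a b n → y + a * n + b * n ≡ (a + b) * n + y
      lem = solve-∀
    val-tree e unit       L c = refl
    val-tree {γ} {g} e (mul s t)  L c = trans
      (val-graft (mono (⟦ s ⟧ γ)) (val-tree e s) (tree g t L c))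
      (cong (fun (⟦ s ⟧ γ)) (val-tree e t L c))
    val-tree e (meet s t) L c = cong₂ _⊓_ (val-tree e s L c) (val-tree e t L c)
    val-tree e (join s t) L c = cong₂ _⊔_ (val-tree e s L c) (val-tree e t L c)

    Formula : Set
    Formula = Σ (Form m) Consts

    _∧ᶠ_ _∨ᶠ_ : Formula → Formula → Formula
    (φ , c) ∧ᶠ (ψ , d) = φ and ψ , (c , d)
    (φ , c) ∨ᶠ (ψ , d) = φ or ψ , (c , d)

    HoldsF : Formula → (Fin m → ℤ) → Set
    HoldsF (φ , c) = Holds φ c

    -- In a chain a minimum on the left or a maximum on the right gives a disjunction, the other two
    -- cases a conjunction. For leaves the difference is (L′ - L) n + (c′ - c), whose sign survives
    -- division by `n` with rounding down.
    le : Tree m → Tree m → Formula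
    le (leaf L c)   (leaf L′ c′) = atom (neg L ++ L′) , (c′ - c) /ℕ n
    le (leaf L c)   (min σ σ′)   = le (leaf L c) σ ∧ᶠ le (leaf L c) σ′
    le (leaf L c)   (max σ σ′)   = le (leaf L c) σ ∨ᶠ le (leaf L c) σ′
    le (min τ τ′)   σ            = le τ σ ∨ᶠ le τ′ σ
    le (max τ τ′)   σ            = le τ σ ∧ᶠ le τ′ σ

    leaf-difference : ∀ L c L′ c′ k → lin (neg L ++ L′) k * + n + (c′ - c) ≡ val (leaf L′ c′) k - val (leaf L c) k
    leaf-difference L c L′ c′ k = trans
      (cong (λ y → y * + n + (c′ - c)) (trans (lin-++ (neg L) L′ k) (cong (_+ lin L′ k) (lin-neg L k))))
      (lem (lin L k) (lin L′ k) c c′ (+ n))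
      where
      lem : ∀ a a′ c c′ n → (- a + a′) * n + (c′ - c) ≡ a′ * n + c′ - (a * n + c)
      lem = solve-∀

    le-sound : ∀ τ σ k → HoldsF (le τ σ) k → val τ k ℤ.≤ val σ k
    le-sound (leaf L c) (leaf L′ c′) k h = ℤₚ.0≤i-j⇒j≤i (subst (0ℤ ℤ.≤_) (leaf-difference L c L′ c′ k)
      (proj₂ (floor-nonneg n (lin (neg L ++ L′) k) (c′ - c)) h))
    le-sound τ@(leaf _ _) (min σ σ′) k (p , q) = ℤₚ.⊓-glb (le-sound τ σ k p) (le-sound τ σ′ k q)
    le-sound τ@(leaf _ _) (max σ σ′) k h = ≤⊎≤⇒≤⊔ (map⊎ (le-sound τ σ k) (le-sound τ σ′ k) h)
    le-sound (min τ τ′) σ k h       = ≤⊎≤⇒⊓≤ (map⊎ (le-sound τ σ k) (le-sound τ′ σ k) h)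
    le-sound (max τ τ′) σ k (p , q) = ℤₚ.⊔-lub (le-sound τ σ k p) (le-sound τ′ σ k q)

    le-complete : ∀ τ σ k → val τ k ℤ.≤ val σ k → HoldsF (le τ σ) k
    le-complete (leaf L c) (leaf L′ c′) k h = proj₁ (floor-nonneg n (lin (neg L ++ L′) k) (c′ - c))
      (subst (0ℤ ℤ.≤_) (sym (leaf-difference L c L′ c′ k)) (ℤₚ.i≤j⇒0≤j-i h))
    le-complete τ@(leaf _ _) (min σ σ′) k h = le-complete τ σ k (proj₁ (≤⊓⇒≤×≤ h)) , le-complete τ σ′ k (proj₂ (≤⊓⇒≤×≤ h))
    le-complete τ@(leaf _ _) (max σ σ′) k h = map⊎ (le-complete τ σ k) (le-complete τ σ′ k) (≤⊔⇒≤⊎≤ h)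
    le-complete (min τ τ′) σ k h = map⊎ (le-complete τ σ k) (le-complete τ′ σ k) (⊓≤⇒≤⊎≤ h)
    le-complete (max τ τ′) σ k h = le-complete τ σ k (proj₁ (⊔≤⇒≤×≤ h)) , le-complete τ′ σ k (proj₂ (⊔≤⇒≤×≤ h))

    val-equal? : ∀ τ σ → Dec (∀ k → val τ k ≡ val σ k)
    val-equal? τ σ = map′
      (λ h k → ℤₚ.≤-antisym (le-sound τ σ k (proj₁ (h k))) (le-sound σ τ k (proj₂ (h k))))
      (λ h k → le-complete τ σ k (ℤₚ.≤-reflexive (h k)) , le-complete σ τ k (ℤₚ.≤-reflexive (sym (h k))))
      (always? (proj₁ both) (proj₂ both))
      where
      both : Formula
      both = le τ σ ∧ᶠ le σ τ

  -- Tables for the finitely many shapes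

  divMod-unique : ∀ {x r} q → r ℕ.< n → x ≡ + r + q * + n → x %ℕ n ≡ r × x /ℕ n ≡ q
  divMod-unique {x} {r} q r<n e = ℤₚ.+-injective (∙-cancelʳ (q * + n) (+ (x %ℕ n)) (+ r)
      (trans (cong (λ y → + (x %ℕ n) + y * + n) (sym q′≡q)) (trans (sym (a≡a%ℕn+[a/ℕn]*n x n)) e))) , q′≡q
    where
    squeeze : ∀ {a b y} → a * + n ℤ.≤ y → y ℤ.< (1ℤ + b) * + n → a ℤ.≤ b
    squeeze {a} {b} h h′ = ≤-move (lem a b) (ℤₚ.i<j⇒suc[i]≤j (ℤₚ.*-cancelʳ-<-nonNeg {a} {1ℤ + b} (+ n) (ℤₚ.≤-<-trans h h′)))
      where
      lem : ∀ a b → 1ℤ + b - (1ℤ + a) ≡ b - a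
      lem = solve-∀
    q*n≤x : q * + n ℤ.≤ x
    q*n≤x = subst (q * + n ℤ.≤_) (sym e) (ℤₚ.i≤j+i (q * + n) (+ r))
    x<sq*n : x ℤ.< (1ℤ + q) * + n
    x<sq*n = subst₂ ℤ._<_ (sym e) (sym (ℤₚ.suc-* q (+ n))) (ℤₚ.+-monoˡ-< (q * + n) (ℤ.+<+ r<n))
    q′≡q : x /ℕ n ≡ q
    q′≡q = ℤₚ.≤-antisym (squeeze ([n/ℕd]*d≤n x n) x<sq*n) (squeeze q*n≤x (n<s[n/ℕd]*d x n))

  periodize : Vec ℕ n → ℤ → ℤ
  periodize v x = + lookup v (fromℕ< (n%ℕd<d x n)) + (x /ℕ n) * + n

  periodize-at : ∀ v {x r} q (p : r ℕ.< n) → x ≡ + r + q * + n → periodize v x ≡ + lookup v (fromℕ< p) + q * + n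
  periodize-at v {x} {r} q p e = cong₂ (λ i y → + lookup v i + y * + n)
    (fromℕ<-cong (x %ℕ n) r (proj₁ (divMod-unique q p e)) (n%ℕd<d x n) p) (proj₂ (divMod-unique q p e))

  periodize-per : ∀ v → Commutes (periodize v) (+ n)
  periodize-per v x = trans
    (periodize-at v (1ℤ + x /ℕ n) (n%ℕd<d x n) (trans (cong (_+ + n) (a≡a%ℕn+[a/ℕn]*n x n)) (lem (+ (x %ℕ n)) (x /ℕ n) (+ n))))
    (sym (lem (+ lookup v (fromℕ< (n%ℕd<d x n))) (x /ℕ n) (+ n)))
    where
    lem : ∀ y q n → y + q * n + n ≡ y + (1ℤ + q) * n
    lem = solve-∀

  -- The last index compares the end of the table with the first value of the next period, so by
  -- periodicity these `n` comparisons cover all consecutive integers.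
  Mono : Vec ℕ n → Set
  Mono v = ∀ (i : Fin n) → periodize v (+ toℕ i) ℤ.≤ periodize v (1ℤ + + toℕ i)

  mono? : ∀ v → Dec (Mono v)
  mono? v = all? λ i → periodize v (+ toℕ i) ℤ.≤? periodize v (1ℤ + + toℕ i)

  stepwise⇒mono : ∀ {f} → (∀ x → f x ℤ.≤ f (1ℤ + x)) → OrderPreserving f
  stepwise⇒mono {f} h {a} {b} a≤b = subst (λ y → f a ℤ.≤ f y)
    (trans (cong (λ y → y + a) (ℤₚ.0≤i⇒+∣i∣≡i (ℤₚ.i≤j⇒0≤j-i a≤b))) (lem a b)) (go ∣ b - a ∣)
    where
    lem : ∀ a b → b - a + a ≡ b
    lem = solve-∀
    go : ∀ j → f a ℤ.≤ f (+ j + a)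
    go zero    = ℤₚ.≤-reflexive (cong f (sym (ℤₚ.+-identityˡ a)))
    go (suc j) = ℤₚ.≤-trans (go j) (subst (λ y → f (+ j + a) ℤ.≤ f y) (sym (ℤₚ.+-assoc 1ℤ (+ j) a)) (h (+ j + a)))

  periodize-stepwise : ∀ v → Mono v → ∀ x → periodize v x ℤ.≤ periodize v (1ℤ + x)
  periodize-stepwise v h x = subst₂ ℤ._≤_ (sym at-x) (sym at-1+x)
    (ℤₚ.+-monoˡ-≤ (q * + n) (subst (λ j → periodize v (+ j) ℤ.≤ periodize v (1ℤ + + j)) (toℕ-fromℕ< (n%ℕd<d x n)) (h (fromℕ< (n%ℕd<d x n)))))
    where
    q : ℤ
    q = x /ℕ n
    r : ℕ
    r = x %ℕ n
    at-x : periodize v x ≡ periodize v (+ r) + q * + n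
    at-x = trans (cong (periodize v) (a≡a%ℕn+[a/ℕn]*n x n)) (commutes-* (periodize v) (periodize-per v) q (+ r))
    at-1+x : periodize v (1ℤ + x) ≡ periodize v (1ℤ + + r) + q * + n
    at-1+x = trans (cong (periodize v) (trans (cong (λ y → 1ℤ + y) (a≡a%ℕn+[a/ℕn]*n x n)) (sym (ℤₚ.+-assoc 1ℤ (+ r) (q * + n)))))
      (commutes-* (periodize v) (periodize-per v) q (1ℤ + + r))

  -- Tables that do not give a monotone map are sent to the identity.
  shape : Vec ℕ n → Per n
  shape v with mono? v
  ... | yes h = record { fun = periodize v ; mono = stepwise⇒mono (periodize-stepwise v h) ; per = periodize-per v }
  ... | no  _ = perId

  shape-fun : ∀ v → Mono v → fun (shape v) ≗ periodize v
  shape-fun v h x with mono? v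
  ... | yes _ = refl
  ... | no ¬h = ⊥-elim (¬h h)

  -- Once f 0 is normalised to lie in [0, n), monotonicity and periodicity put the values on one
  -- period between 0 and f n = f 0 + n < 2 n.
  tables : List (Vec ℕ n)
  tables = vecs (upTo (n ℕ.+ n)) n

  record ShapeOf (f : Per n) : Set where
    field
      table  : Vec ℕ n
      listed : table ∈ tables
      offset : ℤ
      eq     : ∀ x → fun f x ≡ fun (shape table) x + offset * + n

  shapeOf : (f : Per n) → ShapeOf f
  shapeOf f = record
    { table = v ; listed = ∈-vecs v (λ i → ∈-upTo⁺ (subst (ℕ._< n ℕ.+ n) (sym (lookup∘tabulate entry i)) (entry< i)))
    ; offset = k ; eq = λ x → trans (lem₁ (fun f x) (k * + n)) (cong (_+ k * + n) (sym (trans (shape-fun v v-mono x) (periodize-v x)))) }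
    where
    -- Subtracting this multiple of `n` brings the value at 0 into [0, n); by monotonicity all
    -- entries are then nonnegative.
    k : ℤ
    k = fun f 0ℤ /ℕ n
    entry : Fin n → ℕ
    entry i = ∣ fun f (+ toℕ i) - k * + n ∣
    v : Vec ℕ n
    v = tabulate entry
    lem₁ : ∀ y c → y ≡ y - c + c
    lem₁ = solve-∀
    lem₂ : ∀ a b c → a - c + b ≡ a + b - c
    lem₂ = solve-∀
    +entry : ∀ i → + entry i ≡ fun f (+ toℕ i) - k * + n
    +entry i = ℤₚ.0≤i⇒+∣i∣≡i (ℤₚ.i≤j⇒0≤j-i (ℤₚ.≤-trans ([n/ℕd]*d≤n (fun f 0ℤ) n) (mono f (ℤ.+≤+ ℕ.z≤n))))
    entry< : ∀ i → entry i ℕ.< n ℕ.+ n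
    entry< i = ℤₚ.drop‿+<+ (subst (ℤ._< + (n ℕ.+ n)) (sym (+entry i)) (begin-strict
      fun f (+ toℕ i) - k * + n        ≤⟨ ℤₚ.+-monoˡ-≤ (- (k * + n)) (mono f (ℤ.+≤+ (ℕₚ.<⇒≤ (toℕ<n i)))) ⟩
      fun f (0ℤ + + n) - k * + n       ≡⟨ cong (_- k * + n) (per f 0ℤ) ⟩
      fun f 0ℤ + + n - k * + n         <⟨ ℤₚ.+-monoˡ-< (- (k * + n)) (ℤₚ.+-monoˡ-< (+ n) (n<s[n/ℕd]*d (fun f 0ℤ) n)) ⟩
      (1ℤ + k) * + n + + n - k * + n   ≡⟨ lem₃ k (+ n) ⟩
      + n + + n                        ∎))
      where
      open ℤₚ.≤-Reasoning
      lem₃ : ∀ k n → (1ℤ + k) * n + n - k * n ≡ n + n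
      lem₃ = solve-∀
    periodize-v : ∀ x → periodize v x ≡ fun f x - k * + n
    periodize-v x = begin
      + lookup v i + q * + n                        ≡⟨ cong (λ y → + y + q * + n) (lookup∘tabulate entry i) ⟩
      + entry i + q * + n                           ≡⟨ cong (_+ q * + n) (+entry i) ⟩
      fun f (+ toℕ i) - k * + n + q * + n           ≡⟨ lem₂ (fun f (+ toℕ i)) (q * + n) (k * + n) ⟩
      fun f (+ toℕ i) + q * + n - k * + n           ≡⟨ cong (_- k * + n) (per-* f q (+ toℕ i)) ⟨
      fun f (+ toℕ i + q * + n) - k * + n           ≡⟨ cong (λ y → fun f (+ y + q * + n) - k * + n) (toℕ-fromℕ< (n%ℕd<d x n)) ⟩
      fun f (+ (x %ℕ n) + q * + n) - k * + n        ≡⟨ cong (λ y → fun f y - k * + n) (a≡a%ℕn+[a/ℕn]*n x n) ⟨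
      fun f x - k * + n                             ∎
      where
      open ≡-Reasoning
      q : ℤ
      q = x /ℕ n
      i : Fin n
      i = fromℕ< (n%ℕd<d x n)
    v-mono : Mono v
    v-mono i = subst₂ ℤ._≤_ (sym (periodize-v _)) (sym (periodize-v _)) (ℤₚ.+-monoˡ-≤ (- (k * + n)) (mono f (ℤₚ.i≤suc[i] (+ toℕ i))))

  -- Reduction of an equation to finitely many tables and points

  module _ {m : ℕ} (s t : Term) (s≤m : bound s ℕ.≤ m) (t≤m : bound t ℕ.≤ m) where

    shapes : Vec (Vec ℕ n) m → Fin m → Per n
    shapes vs i = shape (lookup vs i)

    tree₀ : Vec (Vec ℕ n) m → NTerm m → Fin n → Tree m
    tree₀ vs u r = tree (shapes vs) u [] (+ toℕ r)

    -- Both sides are periodic, so the points 0, ..., n - 1 decide equality everywhere.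
    AgreeOn : Vec (Vec ℕ n) m → Set
    AgreeOn vs = ∀ r k → val (tree₀ vs (norm s s≤m) r) k ≡ val (tree₀ vs (norm t t≤m) r) k

    agreeOn? : ∀ vs → Dec (AgreeOn vs)
    agreeOn? vs = all? λ r → val-equal? (tree₀ vs (norm s s≤m) r) (tree₀ vs (norm t t≤m) r)

    val-tree₀ : ∀ {γ : Fin m → Per n} vs {k} → (∀ i x → fun (γ i) x ≡ fun (shapes vs i) x + k i * + n) →
      ∀ u r → val (tree₀ vs u r) k ≡ fun (⟦ u ⟧ γ) (+ toℕ r)
    val-tree₀ {γ} vs e u r = trans (val-tree e u [] (+ toℕ r)) (cong (fun (⟦ u ⟧ γ)) (ℤₚ.+-identityˡ (+ toℕ r)))

    agree⇒valid : All AgreeOn (vecs tables m) → Valid n s t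
    agree⇒valid agree ρ f g u v x = begin
      f x                                        ≡⟨ eval-norm {γ = γ} ρ≗γ u s≤m x ⟩
      fun (⟦ norm s s≤m ⟧ γ) x                   ≡⟨ reduce (⟦ norm s s≤m ⟧ γ) ⟩
      fun (⟦ norm s s≤m ⟧ γ) (+ toℕ r) + q * + n ≡⟨ cong (_+ q * + n) (val-tree₀ vs e (norm s s≤m) r) ⟨
      val (tree₀ vs (norm s s≤m) r) k + q * + n  ≡⟨ cong (_+ q * + n) (All.lookup agree vs∈ r k) ⟩
      val (tree₀ vs (norm t t≤m) r) k + q * + n  ≡⟨ cong (_+ q * + n) (val-tree₀ vs e (norm t t≤m) r) ⟩
      fun (⟦ norm t t≤m ⟧ γ) (+ toℕ r) + q * + n ≡⟨ reduce (⟦ norm t t≤m ⟧ γ) ⟨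
      fun (⟦ norm t t≤m ⟧ γ) x                   ≡⟨ eval-norm {γ = γ} ρ≗γ v t≤m x ⟨
      g x                                        ∎
      where
      open ≡-Reasoning
      open ShapeOf
      γ : Fin m → Per n
      γ i = fromFn (ρ (toℕ i))
      ρ≗γ : ∀ {i} (p : i ℕ.< m) → Fn.fun (ρ i) ≗ fun (γ (fromℕ< p))
      ρ≗γ p x = cong (λ j → Fn.fun (ρ j) x) (sym (toℕ-fromℕ< p))
      vs : Vec (Vec ℕ n) m
      vs = tabulate (λ i → table (shapeOf (γ i)))
      vs-at : ∀ i → lookup vs i ≡ table (shapeOf (γ i))
      vs-at = lookup∘tabulate _
      vs∈ : vs ∈ vecs tables m
      vs∈ = ∈-vecs vs λ i → subst (_∈ tables) (sym (vs-at i)) (listed (shapeOf (γ i)))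
      k : Fin m → ℤ
      k i = offset (shapeOf (γ i))
      e : ∀ i x → fun (γ i) x ≡ fun (shapes vs i) x + k i * + n
      e i x = trans (eq (shapeOf (γ i)) x) (cong (λ w → fun (shape w) x + k i * + n) (sym (vs-at i)))
      q : ℤ
      q = x /ℕ n
      r : Fin n
      r = fromℕ< (n%ℕd<d x n)
      reduce : (h : Per n) → fun h x ≡ fun h (+ toℕ r) + q * + n
      reduce h = trans (cong (fun h) (trans (a≡a%ℕn+[a/ℕn]*n x n)
        (cong (λ j → + j + q * + n) (sym (toℕ-fromℕ< (n%ℕd<d x n)))))) (per-* h q (+ toℕ r))

    valid⇒agree : Valid n s t → ∀ vs → AgreeOn vs
    valid⇒agree valid vs r k = begin
      val (tree₀ vs (norm s s≤m) r) k   ≡⟨ val-tree₀ vs e (norm s s≤m) r ⟩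
      fun (⟦ norm s s≤m ⟧ γ) (+ toℕ r)  ≡⟨ eval-norm {γ = γ} ρ≗γ (proj₂ F) s≤m (+ toℕ r) ⟨
      proj₁ F (+ toℕ r)                 ≡⟨ valid ρ (proj₁ F) (proj₁ G) (proj₂ F) (proj₂ G) (+ toℕ r) ⟩
      proj₁ G (+ toℕ r)                 ≡⟨ eval-norm {γ = γ} ρ≗γ (proj₂ G) t≤m (+ toℕ r) ⟩
      fun (⟦ norm t t≤m ⟧ γ) (+ toℕ r)  ≡⟨ val-tree₀ vs e (norm t t≤m) r ⟨
      val (tree₀ vs (norm t t≤m) r) k   ∎
      where
      open ≡-Reasoning
      γ : Fin m → Per n
      γ i = perShift (k i) (shapes vs i)
      e : ∀ i x → fun (γ i) x ≡ fun (shapes vs i) x + k i * + n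
      e i x = refl
      -- Variables with index `m` or more occur in neither term; the identity fills their places.
      γ̂ : ∀ i → Dec (i ℕ.< m) → Per n
      γ̂ i (yes p) = γ (fromℕ< p)
      γ̂ i (no _)  = perId
      ρ : ℕ → Fn n
      ρ i = toFn (γ̂ i (i ℕ.<? m))
      γ̂≗γ : ∀ {i} (p : i ℕ.< m) d → fun (γ̂ i d) ≗ fun (γ (fromℕ< p))
      γ̂≗γ p (yes p′) x = refl
      γ̂≗γ p (no ¬p)  x = ⊥-elim (¬p p)
      ρ≗γ : ∀ {i} (p : i ℕ.< m) → Fn.fun (ρ i) ≗ fun (γ (fromℕ< p))
      ρ≗γ {i} p = γ̂≗γ p (i ℕ.<? m)
      F : Σ (ℤ → ℤ) (Eval ρ s)
      F = eval-exists {γ = γ} ρ≗γ s s≤m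
      G : Σ (ℤ → ℤ) (Eval ρ t)
      G = eval-exists {γ = γ} ρ≗γ t t≤m

theorem4p12 : (n : ℕ) → 1 ≤ n → (s t : Term) → Dec (Valid n s t)
theorem4p12 n 1≤n s t = map′ (agree⇒valid s t s≤m t≤m) (λ valid → All.universal (valid⇒agree s t s≤m t≤m valid) _)
                          (All.all? (agreeOn? s t s≤m t≤m) (vecs tables m))
  where
  instance
    n-nonZero : NonZero n
    n-nonZero = ℕ.>-nonZero 1≤n
  m : ℕ
  m = bound s ℕ.⊔ bound t
  s≤m : bound s ℕ.≤ m
  s≤m = ℕₚ.m≤m⊔n (bound s) (bound t)
  t≤m : bound t ℕ.≤ m
  t≤m = ℕₚ.m≤n⊔m (bound s) (bound t)
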